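{- If $\tau=1020$ or $\tau=1022$, then $$f_\tau(x)=\frac{1-9x+32x^2-56x^3+49x^4-19x^5+x^6}{(1-x)(1-2x)^3(1-3x+x^2)}$$ as formal power series in $x$, where $f_\tau(x)=\sum_{n\ge 0} b_n(\tau)x^n$ and $b_n(\tau)$ is the number of ascent sequences of length $n$ that avoid both patterns $021$ and $\tau$.
   Context: For a finite sequence $w=w_1\cdots w_n$ of integers, $\mathrm{asc}(w)$ is the number of indices $1\le i\le n-1$ with $w_i<w_{i+1}$. An ascent sequence of length $n\ge 1$ is a sequence $a_1\cdots a_n$ of non-negative integers such that $a_1=0$ and $a_i\le \mathrm{asc}(a_1\cdots a_{i-1})+1$ for $1<i\le n$; there is exactly one (empty) ascent sequence of length $0$. A sequence $\pi=\pi_1\cdots\pi_n$ contains a pattern $\tau=\tau_1\cdots\tau_m$ if there are indices $1\le i_1<\cdots<i_m\le n$ such that for all $j,k\in\{1,\dots,m\}$: $\pi_{i_j}<\pi_{i_k}$ iff $\tau_j<\tau_k$, and $\pi_{i_j}=\pi_{i_k}$ iff $\tau_j=\tau_k$; otherwise $\pi$ avoids $\tau$. For a pattern $\tau$, $B_n(\tau)$ is the set of ascent sequences of length $n$ avoiding both $021$ and $\tau$ (with $B_0(\tau)$ consisting of the empty sequence), and $b_n(\tau)=|B_n(\tau)|$. -}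

module Defs where

open import Data.Bool.Base using (true; false; if_then_else_)
open import Data.Fin.Base as Fin using (Fin; toℕ)
open import Data.Fin.Properties as Fin using (any?; all?; toℕ<n)
open import Data.Integer.Base as ℤ using (ℤ; 0ℤ; 1ℤ)
import Data.Integer.Properties as ℤ
open import Data.List.Base
  using (List; []; _∷_; length; lookup; take; filter; upTo; cartesianProductWith)
open import Data.List.Membership.Propositional using (_∈_)
open import Data.List.Membership.Propositional.Properties
  using (∈-filter⁺; ∈-filter⁻; ∈-upTo⁺; ∈-cartesianProductWith⁺; ∈-cartesianProductWith⁻)
open import Data.List.Properties using (∷-injective; length-take)
open import Data.List.Relation.Unary.Any using (here)
open import Data.List.Relation.Unary.All using ([])
open import Data.List.Relation.Unary.AllPairs using ([]; _∷_)
open import Data.List.Relation.Unary.Unique.Propositional using (Unique)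
import Data.List.Relation.Unary.Unique.Propositional.Properties as Unique
open import Data.Nat.Base
open import Data.Nat.Induction using (<-rec)
open import Data.Nat.Properties
open import Data.Product.Base using (∃; _×_; _,_; proj₁; proj₂)
open import Data.Vec.Base as Vec using (Vec)
open import Function.Base using (_∘_)
open import Function.Bundles using (_⇔_; mk⇔; Equivalence)
open import Relation.Binary.PropositionalEquality
open import Relation.Nullary.Decidable
  using (Dec; yes; no; map′; _×-dec_; _→-dec_; ¬?)
open import Relation.Nullary.Negation using (¬_)
open import Relation.Unary using (Decidable)

import Algebra.Properties.CommutativeMonoid.Sum ℤ.+-0-commutativeMonoid as Sum
import Algebra.Properties.AbelianGroup ℤ.+-0-abelianGroup as ℤGroup

------------------------------------------------------------------------
-- Ascent sequences

asc : List ℕ → ℕ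
asc []          = 0
asc (x ∷ [])    = 0
asc (x ∷ y ∷ w) = if x <ᵇ y then suc (asc (y ∷ w)) else asc (y ∷ w)

-- Positions are 0-based, so `take (toℕ i) w` consists of the entries
-- strictly before position i.
record IsAscentSequence (w : List ℕ) : Set where
  constructor isAscentSequence
  field
    first : ∀ (i : Fin (length w)) → toℕ i ≡ 0 → lookup w i ≡ 0
    later : ∀ (i : Fin (length w)) → 0 < toℕ i →
            lookup w i ≤ asc (take (toℕ i) w) + 1

------------------------------------------------------------------------
-- Pattern containment

StrictlyIncreasing : ∀ {m n} → Vec (Fin n) m → Set
StrictlyIncreasing ι = ∀ j k → j Fin.< k → Vec.lookup ι j Fin.< Vec.lookup ι k

IsOccurrence : (π τ : List ℕ) → Vec (Fin (length π)) (length τ) → Set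
IsOccurrence π τ ι = StrictlyIncreasing ι ×
  (∀ j k →
    (lookup π (Vec.lookup ι j) < lookup π (Vec.lookup ι k) ⇔ lookup τ j < lookup τ k) ×
    (lookup π (Vec.lookup ι j) ≡ lookup π (Vec.lookup ι k) ⇔ lookup τ j ≡ lookup τ k))

Contains : (π τ : List ℕ) → Set
Contains π τ = ∃ (IsOccurrence π τ)

Avoids : (π τ : List ℕ) → Set
Avoids π τ = ¬ Contains π τ

pattern021 pattern1020 pattern1022 : List ℕ
pattern021  = 0 ∷ 2 ∷ 1 ∷ []
pattern1020 = 1 ∷ 0 ∷ 2 ∷ 0 ∷ []
pattern1022 = 1 ∷ 0 ∷ 2 ∷ 2 ∷ []

InB : ℕ → List ℕ → List ℕ → Set
InB n τ w = length w ≡ n × IsAscentSequence w × Avoids w pattern021 × Avoids w τ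

------------------------------------------------------------------------
-- Decidability

isAscentSequence? : Decidable IsAscentSequence
isAscentSequence? w = map′
  (λ (p , q) → isAscentSequence p q)
  (λ (isAscentSequence p q) → p , q)
  (all? (λ i → (toℕ i ≟ 0) →-dec (lookup w i ≟ 0)) ×-dec
   all? (λ i → (0 <? toℕ i) →-dec (lookup w i ≤? asc (take (toℕ i) w) + 1)))

private
  _⇔-dec_ : {A B : Set} → Dec A → Dec B → Dec (A ⇔ B)
  a? ⇔-dec b? = map′ (λ (f , g) → mk⇔ f g)
                     (λ e → Equivalence.to e , Equivalence.from e)
                     ((a? →-dec b?) ×-dec (b? →-dec a?))

  anyVec? : ∀ {n} m {P : Vec (Fin n) m → Set} → Decidable P → Dec (∃ P)
  anyVec? zero    P? = map′ (λ p → Vec.[] , p) (λ { (Vec.[] , p) → p }) (P? Vec.[])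
  anyVec? (suc m) P? = map′
    (λ (i , ι , p) → i Vec.∷ ι , p)
    (λ { (i Vec.∷ ι , p) → i , ι , p })
    (any? (λ i → anyVec? m (λ ι → P? (i Vec.∷ ι))))

isOccurrence? : ∀ π τ → Decidable (IsOccurrence π τ)
isOccurrence? π τ ι =
  all? (λ j → all? (λ k → (j Fin.<? k) →-dec (Vec.lookup ι j Fin.<? Vec.lookup ι k))) ×-dec
  all? (λ j → all? (λ k →
    ((lookup π (Vec.lookup ι j) <? lookup π (Vec.lookup ι k)) ⇔-dec (lookup τ j <? lookup τ k)) ×-dec
    ((lookup π (Vec.lookup ι j) ≟ lookup π (Vec.lookup ι k)) ⇔-dec (lookup τ j ≟ lookup τ k))))

contains? : ∀ π τ → Dec (Contains π τ)
contains? π τ = anyVec? (length τ) (isOccurrence? π τ)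

inB? : ∀ n τ → Decidable (InB n τ)
inB? n τ w = (length w ≟ n) ×-dec isAscentSequence? w ×-dec
             ¬? (contains? w pattern021) ×-dec ¬? (contains? w τ)

------------------------------------------------------------------------
-- Counting

words : (k n : ℕ) → List (List ℕ)
words k zero    = [] ∷ []
words k (suc n) = cartesianProductWith _∷_ (upTo k) (words k n)

-- Entries of an ascent sequence of length n are smaller than n, so searching
-- `words n n` loses nothing; see `∈-B` and `B-unique`.
B : ℕ → List ℕ → List (List ℕ)
B n τ = filter (inB? n τ) (words n n)

b : ℕ → List ℕ → ℕ
b n τ = length (B n τ)

private
  asc≤ : ∀ w → asc w ≤ length w ∸ 1
  asc≤ []          = z≤n
  asc≤ (x ∷ [])    = z≤n
  asc≤ (x ∷ y ∷ w) with x <ᵇ y | asc≤ (y ∷ w)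
  ... | true  | ih = s≤s ih
  ... | false | ih = m≤n⇒m≤1+n ih

  entry< : ∀ {w} → IsAscentSequence w → ∀ i → lookup w i < length w
  entry< {w} (isAscentSequence first later) i with toℕ i ≟ 0
  ... | yes i≡0 = subst (_< length w) (trans i≡0 (sym (first i i≡0))) (toℕ<n i)
  ... | no  i≢0 = begin-strict
    lookup w i                          ≤⟨ later i (n≢0⇒n>0 i≢0) ⟩
    asc (take (toℕ i) w) + 1            ≤⟨ +-monoˡ-≤ 1 (asc≤ (take (toℕ i) w)) ⟩
    (length (take (toℕ i) w) ∸ 1) + 1   ≡⟨ cong (λ l → (l ∸ 1) + 1) (length-take (toℕ i) w) ⟩
    (toℕ i ⊓ length w ∸ 1) + 1          ≤⟨ +-monoˡ-≤ 1 (∸-monoˡ-≤ 1 (m⊓n≤m (toℕ i) (length w))) ⟩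
    (toℕ i ∸ 1) + 1                     ≡⟨ m∸n+n≡m (n≢0⇒n>0 i≢0) ⟩
    toℕ i                               <⟨ toℕ<n i ⟩
    length w                            ∎
    where open ≤-Reasoning

  ∈-words : ∀ {k} w → (∀ i → lookup w i < k) → w ∈ words k (length w)
  ∈-words []      _ = here refl
  ∈-words (x ∷ w) h =
    ∈-cartesianProductWith⁺ _∷_ (∈-upTo⁺ (h Fin.zero)) (∈-words w (h ∘ Fin.suc))

  words-unique : ∀ k n → Unique (words k n)
  words-unique k zero    = [] ∷ []
  words-unique k (suc n) =
    Unique.cartesianProductWith⁺ _∷_ ∷-injective (Unique.upTo⁺ k) (words-unique k n)

∈-B : ∀ n τ w → w ∈ B n τ ⇔ InB n τ w
∈-B n τ w = mk⇔ (proj₂ ∘ ∈-filter⁻ (inB? n τ) {xs = words n n}) from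
  where
  from : ∀ {n} → InB n τ w → w ∈ B n τ
  from p@(refl , a , _) = ∈-filter⁺ (inB? _ τ) (∈-words w (entry< a)) p

B-unique : ∀ n τ → Unique (B n τ)
B-unique n τ = Unique.filter⁺ (inB? n τ) (words-unique n n)

------------------------------------------------------------------------
-- Formal power series over ℤ, as coefficient sequences

Series : Set
Series = ℕ → ℤ

infixl 7 _⊛_
_⊛_ : Series → Series → Series
(f ⊛ g) n = Sum.sum {suc n} (λ i → f (toℕ i) ℤ.* g (n ∸ toℕ i))

-- The coefficient list starts with the constant term.
polynomial : List ℤ → Series
polynomial []       n       = 0ℤ
polynomial (c ∷ cs) zero    = c
polynomial (c ∷ cs) (suc n) = polynomial cs n

infixr 8 _^ˢ_
_^ˢ_ : Series → ℕ → Series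
f ^ˢ zero  = polynomial (1ℤ ∷ [])
f ^ˢ suc k = f ⊛ f ^ˢ k

-- f = p / q in ℤ[[x]].  The constant term 1 makes q invertible, so f is
-- determined by p and q; see `quotient-unique`.
infix 4 _≈_/ˢ_
_≈_/ˢ_ : Series → Series → Series → Set
f ≈ p /ˢ q = q 0 ≡ 1ℤ × (∀ n → (q ⊛ f) n ≡ p n)

quotient-unique : ∀ {f g p q} → f ≈ p /ˢ q → g ≈ p /ˢ q → ∀ n → f n ≡ g n
quotient-unique {f} {g} {p} {q} (q₀ , qf) (_ , qg) = <-rec _ step
  where
  tail : Series → ∀ n → ℤ
  tail h n = Sum.sum {n} (λ i → q (suc (toℕ i)) ℤ.* h (n ∸ suc (toℕ i)))

  head≡ : ∀ h n → q 0 ℤ.* h n ≡ h n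
  head≡ h n = trans (cong (ℤ._* h n) q₀) (ℤ.*-identityˡ (h n))

  step : ∀ n → (∀ {m} → m < n → f m ≡ g m) → f n ≡ g n
  step n ih = begin
    f n          ≡⟨ head≡ f n ⟨
    q 0 ℤ.* f n  ≡⟨ ℤGroup.∙-cancelʳ (tail f n) _ _ sums≡ ⟩
    q 0 ℤ.* g n  ≡⟨ head≡ g n ⟩
    g n          ∎
    where
    open ≡-Reasoning
    earlier : ∀ (i : Fin n) → n ∸ suc (toℕ i) < n
    earlier i = ∸-monoʳ-< {n} {suc (toℕ i)} {0} (s≤s z≤n) (toℕ<n i)

    tails≡ : tail g n ≡ tail f n
    tails≡ = Sum.sum-cong-≗ (λ i → cong (q (suc (toℕ i)) ℤ.*_) (sym (ih (earlier i))))

    sums≡ : q 0 ℤ.* f n ℤ.+ tail f n ≡ q 0 ℤ.* g n ℤ.+ tail f n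
    sums≡ = trans (trans (qf n) (sym (qg n))) (cong (λ t → q 0 ℤ.* g n ℤ.+ t) tails≡)

generatingFunction : List ℕ → Series
generatingFunction τ n = ℤ.+ b n τ

{-# OPTIONS --safe #-}

-- The nonzero entries of a 021-avoiding ascent sequence increase weakly, so an occurrence
-- of 1020 (of 1022) in it is a subsequence x 0 y 0 (x 0 y y) with 0 < x < y.  Reading
-- from left to right, only the maximum, the last entry, the number of ascents and the
-- longest prefix of the pattern read so far matter.  For both patterns, once x 0 y has
-- been read, exactly one value not above the maximum may follow, the maximum for 1020 and
-- 0 for 1022, and it leaves the slack d = (number of ascents) − (maximum) unchanged.
-- Hence both patterns are counted by the same automaton.
--
-- The slack is unbounded, but the generating function of the words readable from a state
-- with slack d depends on d geometrically, with ratio (1 − x)/(1 − 2x).  This leaves a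
-- linear recurrence in six unknowns, whose reversed characteristic
-- polynomial is the denominator.

module Submission where

open import Defs
open import Data.Bool.Base as Bool using (true; false)
open import Data.Fin.Base as Fin using (Fin; toℕ)
open import Data.Fin.Patterns using (0F; 1F; 2F; 3F)
open import Data.Integer.Base as ℤ using (+_; -_)
import Data.Integer.Properties as ℤ
import Data.Integer.Tactic.RingSolver as ℤ-RingSolver
open import Data.List.Base
  using (List; []; _∷_; map; length; lookup; take; applyUpTo; concatMap)
import Data.List.Properties as List
open import Data.List.Membership.Propositional using (_∈_; find; lose)
open import Data.List.Membership.Propositional.Properties
open import Data.List.Membership.Propositional.Properties.WithK using (unique∧set⇒bag)
open import Data.List.Relation.Binary.BagAndSetEquality using (∼bag⇒↭)
open import Data.List.Relation.Binary.Disjoint.Propositional using (Disjoint)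
open import Data.List.Relation.Binary.Permutation.Propositional.Properties using (↭-length)
open import Data.List.Relation.Binary.Sublist.Propositional
  using (_⊆_; []; _∷_; _∷ʳ_; minimum; ⊆-trans)
open import Data.List.Relation.Binary.Sublist.Propositional.Properties using (∷ˡ⁻)
open import Data.List.Relation.Unary.All as All using (All; []; _∷_)
import Data.List.Relation.Unary.All.Properties as All
open import Data.List.Relation.Unary.AllPairs as AllPairs using (AllPairs; []; _∷_)
import Data.List.Relation.Unary.AllPairs.Properties as AllPairs
open import Data.List.Relation.Unary.Any using (here; there)
open import Data.List.Relation.Unary.Unique.Propositional using (Unique)
import Data.List.Relation.Unary.Unique.Propositional.Properties as Unique
open import Data.Nat.Base as ℕ using (ℕ)
import Data.Nat.Properties as ℕ
open import Data.Nat.ListAction using (sum)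
import Data.Nat.Tactic.RingSolver as ℕ-RingSolver
open import Data.Product.Base using (∃; ∃₂; _×_; _,_; proj₁; proj₂)
open import Data.Sum.Base using (_⊎_; inj₁; inj₂)
open import Data.Vec.Base as Vec using (Vec)
import Data.Vec.Properties as Vec
open import Function.Base using (_∘_; _on_; id; const)
open import Function.Bundles using (mk⇔; Equivalence)
open import Relation.Binary.Definitions using (tri<; tri≈; tri>)
open import Relation.Binary.PropositionalEquality
open import Relation.Nullary.Decidable using (yes; no)
open import Relation.Nullary.Negation using (¬_; contradiction)

import Algebra.Properties.CommutativeMonoid.Sum ℤ.+-0-commutativeMonoid as Sum

module SeriesAlgebra where
  open import Data.Integer.Base using (ℤ; 0ℤ; 1ℤ; _+_; _*_; _-_)
  open import Data.Nat.Base using (zero; suc)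

  -- Polynomial arithmetic

  ⊛-congˡ : ∀ {f f′ : Series} g → f ≗ f′ → f ⊛ g ≗ f′ ⊛ g
  ⊛-congˡ g f≗f′ n = Sum.sum-cong-≗ {suc n} λ i → cong (_* g (n ℕ.∸ toℕ i)) (f≗f′ (toℕ i))

  ⊛-congʳ : ∀ f {g g′ : Series} → g ≗ g′ → f ⊛ g ≗ f ⊛ g′
  ⊛-congʳ f g≗g′ n = Sum.sum-cong-≗ {suc n} λ i → cong (f (toℕ i) *_) (g≗g′ (n ℕ.∸ toℕ i))

  zero⊛ : ∀ f n → (polynomial [] ⊛ f) n ≡ 0ℤ
  zero⊛ f zero    = refl
  zero⊛ f (suc n) = trans (ℤ.+-identityˡ _) (zero⊛ f n)

  infixl 6 _⊞_
  _⊞_ : List ℤ → List ℤ → List ℤ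
  []       ⊞ r        = r
  (c ∷ p) ⊞ []       = c ∷ p
  (c ∷ p) ⊞ (d ∷ r) = c + d ∷ p ⊞ r

  polynomial-⊞ : ∀ p r n → polynomial (p ⊞ r) n ≡ polynomial p n + polynomial r n
  polynomial-⊞ []      r       n       = sym (ℤ.+-identityˡ _)
  polynomial-⊞ (c ∷ p) []      n       = sym (ℤ.+-identityʳ _)
  polynomial-⊞ (c ∷ p) (d ∷ r) zero    = refl
  polynomial-⊞ (c ∷ p) (d ∷ r) (suc n) = polynomial-⊞ p r n

  polynomial-map : ∀ c r n → polynomial (map (c *_) r) n ≡ c * polynomial r n
  polynomial-map c []      n       = sym (ℤ.*-zeroʳ c)
  polynomial-map c (d ∷ r) zero    = refl
  polynomial-map c (d ∷ r) (suc n) = polynomial-map c r n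

  infixl 7 _⊠_
  _⊠_ : List ℤ → List ℤ → List ℤ
  []      ⊠ r = []
  (c ∷ p) ⊠ r = map (c *_) r ⊞ (0ℤ ∷ p ⊠ r)

  polynomial-⊠ : ∀ p r → polynomial p ⊛ polynomial r ≗ polynomial (p ⊠ r)
  polynomial-⊠ []      r n = zero⊛ (polynomial r) n
  polynomial-⊠ (c ∷ p) r n = trans (unfold n) (sym (trans
    (polynomial-⊞ (map (c *_) r) (0ℤ ∷ p ⊠ r) n)
    (cong (_+ polynomial (0ℤ ∷ p ⊠ r) n) (polynomial-map c r n))))
    where
    unfold : ∀ n → (polynomial (c ∷ p) ⊛ polynomial r) n ≡
                   c * polynomial r n + polynomial (0ℤ ∷ p ⊠ r) n
    unfold zero    = refl
    -- The terms of the convolution with positive index are, definitionally, the convolution of the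
    -- tail at `n`.
    unfold (suc n) = cong (_+_ (c * polynomial r (suc n))) (polynomial-⊠ p r n)

  infixr 8 _⊠^_
  _⊠^_ : List ℤ → ℕ → List ℤ
  p ⊠^ zero  = 1ℤ ∷ []
  p ⊠^ suc k = p ⊠ p ⊠^ k

  polynomial-⊠^ : ∀ p k → polynomial p ^ˢ k ≗ polynomial (p ⊠^ k)
  polynomial-⊠^ p zero    n = refl
  polynomial-⊠^ p (suc k) n = trans
    (⊛-congʳ (polynomial p) (polynomial-⊠^ p k) n) (polynomial-⊠ p (p ⊠^ k) n)

  denominator : Series
  denominator = polynomial (+ 1 ∷ - (+ 1) ∷ [])
                ⊛ polynomial (+ 1 ∷ - (+ 2) ∷ []) ^ˢ 3
                ⊛ polynomial (+ 1 ∷ - (+ 3) ∷ + 1 ∷ [])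

  expansion : List ℤ
  expansion = + 1 ∷ - (+ 10) ∷ + 40 ∷ - (+ 81) ∷ + 86 ∷ - (+ 44) ∷ + 8 ∷ []

  denominator-expanded : denominator ≗ polynomial expansion
  denominator-expanded n = trans
    (⊛-congˡ (polynomial (+ 1 ∷ - (+ 3) ∷ + 1 ∷ [])) (λ k → trans
      (⊛-congʳ (polynomial (+ 1 ∷ - (+ 1) ∷ [])) (polynomial-⊠^ (+ 1 ∷ - (+ 2) ∷ []) 3) k)
      (polynomial-⊠ (+ 1 ∷ - (+ 1) ∷ []) ((+ 1 ∷ - (+ 2) ∷ []) ⊠^ 3) k)) n)
    (polynomial-⊠ ((+ 1 ∷ - (+ 1) ∷ []) ⊠ (+ 1 ∷ - (+ 2) ∷ []) ⊠^ 3) (+ 1 ∷ - (+ 3) ∷ + 1 ∷ []) n)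

  -- Linear recurrences

  -- The six unknowns will count the words readable from `T 0 0`, `T 0 1`, `Z 0`, `O 1`, `P 0` and
  -- `zeros`.
  record Solution (t₀ t₁ z o p a : ℕ → ℤ) : Set where
    field
      t₀-suc : ∀ n → t₀ (suc n) ≡ t₀ n + t₀ n
      t₁-suc : ∀ n → t₁ (suc n) ≡ t₁ n + (t₁ n + t₀ n)
      z-suc  : ∀ n → z (suc n) ≡ z n + (o n + t₀ n)
      o-suc  : ∀ n → o (suc n) ≡ o n + o n + (z n + t₀ n)
      p-suc  : ∀ n → p (suc n) ≡ t₁ n + (p n + p n)
      a-suc  : ∀ n → a (suc n) ≡ a n + (o n - z n + (p n - t₁ n + t₀ n))

  module _ {t₀ t₁ z o p a : ℕ → ℤ} (solution : Solution t₀ t₁ z o p a) where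
    open Solution solution

    record Form : Set where
      constructor form
      field c₀ c₁ c₂ c₃ c₄ c₅ : ℤ

    value : Form → ℕ → ℤ
    value (form c₀ c₁ c₂ c₃ c₄ c₅) n =
      c₀ * t₀ n + (c₁ * t₁ n + (c₂ * z n + (c₃ * o n + (c₄ * p n + c₅ * a n))))

    -- The transposed transition matrix: advancing the argument becomes an operation on coefficients
    -- that no longer mentions `n`.
    shift : Form → Form
    shift (form c₀ c₁ c₂ c₃ c₄ c₅) = form
      (+ 2 * c₀ + c₁ + c₂ + c₃ + c₅) (+ 2 * c₁ + c₄ - c₅)
      (c₂ + c₃ - c₅) (c₂ + + 2 * c₃ + c₅) (+ 2 * c₄ + c₅) c₅

    value-suc : ∀ φ n → value φ (suc n) ≡ value (shift φ) n
    value-suc (form c₀ c₁ c₂ c₃ c₄ c₅) n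
      rewrite t₀-suc n | t₁-suc n | z-suc n | o-suc n | p-suc n | a-suc n =
      identity c₀ c₁ c₂ c₃ c₄ c₅ (t₀ n) (t₁ n) (z n) (o n) (p n) (a n)
      where
      identity : ∀ c₀ c₁ c₂ c₃ c₄ c₅ t₀ t₁ z o p a →
        c₀ * (t₀ + t₀) + (c₁ * (t₁ + (t₁ + t₀)) + (c₂ * (z + (o + t₀)) +
          (c₃ * (o + o + (z + t₀)) + (c₄ * (t₁ + (p + p)) +
          c₅ * (a + (o - z + (p - t₁ + t₀))))))) ≡
        (+ 2 * c₀ + c₁ + c₂ + c₃ + c₅) * t₀ + ((+ 2 * c₁ + c₄ - c₅) * t₁ +
          ((c₂ + c₃ - c₅) * z + ((c₂ + + 2 * c₃ + c₅) * o +
          ((+ 2 * c₄ + c₅) * p + c₅ * a))))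
      identity = ℤ-RingSolver.solve-∀

    shifts : ℕ → Form
    shifts zero    = form 0ℤ 0ℤ 0ℤ 0ℤ 0ℤ 1ℤ
    shifts (suc i) = shift (shifts i)

    a-shifted : ∀ i n → a (i ℕ.+ n) ≡ value (shifts i) n
    a-shifted zero    n = identity (t₀ n) (t₁ n) (z n) (o n) (p n) (a n)
      where
      identity : ∀ t₀ t₁ z o p a →
        a ≡ 0ℤ * t₀ + (0ℤ * t₁ + (0ℤ * z + (0ℤ * o + (0ℤ * p + 1ℤ * a))))
      identity = ℤ-RingSolver.solve-∀
    a-shifted (suc i) n = trans
      (cong a (sym (ℕ.+-suc i n)))
      (trans (a-shifted i (suc n)) (value-suc (shifts i) n))

    combination : List ℤ → Form
    combination []       = form 0ℤ 0ℤ 0ℤ 0ℤ 0ℤ 0ℤ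
    -- In a convolution the constant term meets the largest index, so the head of the list goes with
    -- the largest shift.
    combination (c ∷ cs) = add c (shifts (length cs)) (combination cs)
      where
      add : ℤ → Form → Form → Form
      add c (form c₀ c₁ c₂ c₃ c₄ c₅) (form d₀ d₁ d₂ d₃ d₄ d₅) = form
        (c * c₀ + d₀) (c * c₁ + d₁) (c * c₂ + d₂) (c * c₃ + d₃) (c * c₄ + d₄) (c * c₅ + d₅)

    -- The last coefficient of `cs` meets `f (suc n)`, that is `a n`, so every value of `f` with a
    -- coefficient from `cs` is a value of `a`.
    ⊛-value : ∀ f → (∀ n → f (suc n) ≡ a n) → ∀ cs n →
      (polynomial cs ⊛ f) (length cs ℕ.+ n) ≡ value (combination cs) n
    ⊛-value f f-suc []       n = trans (zero⊛ f n) (identity (t₀ n) (t₁ n) (z n) (o n) (p n) (a n))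
      where
      identity : ∀ t₀ t₁ z o p a →
        0ℤ ≡ 0ℤ * t₀ + (0ℤ * t₁ + (0ℤ * z + (0ℤ * o + (0ℤ * p + 0ℤ * a))))
      identity = ℤ-RingSolver.solve-∀
    ⊛-value f f-suc (c ∷ cs) n = trans
      (cong₂ (λ x y → c * x + y)
        (trans (f-suc (length cs ℕ.+ n)) (a-shifted (length cs) n)) (⊛-value f f-suc cs n))
      (identity c c₀ c₁ c₂ c₃ c₄ c₅ d₀ d₁ d₂ d₃ d₄ d₅ (t₀ n) (t₁ n) (z n) (o n) (p n) (a n))
      where
      open Form (shifts (length cs))
      open Form (combination cs) renaming
        (c₀ to d₀; c₁ to d₁; c₂ to d₂; c₃ to d₃; c₄ to d₄; c₅ to d₅)
      identity : ∀ c c₀ c₁ c₂ c₃ c₄ c₅ d₀ d₁ d₂ d₃ d₄ d₅ t₀ t₁ z o p a →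
        c * (c₀ * t₀ + (c₁ * t₁ + (c₂ * z + (c₃ * o + (c₄ * p + c₅ * a))))) +
        (d₀ * t₀ + (d₁ * t₁ + (d₂ * z + (d₃ * o + (d₄ * p + d₅ * a))))) ≡
        (c * c₀ + d₀) * t₀ + ((c * c₁ + d₁) * t₁ + ((c * c₂ + d₂) * z +
          ((c * c₃ + d₃) * o + ((c * c₄ + d₄) * p + (c * c₅ + d₅) * a))))
      identity = ℤ-RingSolver.solve-∀

    annihilated : ∀ f → (∀ n → f (suc n) ≡ a n) → ∀ n → (denominator ⊛ f) (7 ℕ.+ n) ≡ 0ℤ
    annihilated f f-suc n = begin
      (denominator ⊛ f) (7 ℕ.+ n)               ≡⟨ ⊛-congˡ {denominator} {polynomial expansion} f
                                                      denominator-expanded (7 ℕ.+ n) ⟩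
      (polynomial expansion ⊛ f) (7 ℕ.+ n)      ≡⟨ ⊛-value f f-suc expansion n ⟩
      value (combination expansion) n           ≡⟨ cong (λ φ → value φ n) vanishes ⟩
      value (combination []) n                  ≡⟨ ⊛-value f f-suc [] n ⟨
      (polynomial [] ⊛ f) n                     ≡⟨ zero⊛ f n ⟩
      0ℤ                                        ∎
      where
      open ≡-Reasoning
      vanishes : combination expansion ≡ combination []
      -- A closed computation on six integers: as in the Cayley-Hamilton theorem, the characteristic
      -- polynomial of the recurrence annihilates it.
      vanishes = refl

open import Data.Nat.Base
open import Data.Nat.Properties

-- Deterministic automata

module Automaton {State : Set} (moves : State → List (ℕ × State)) where

  language : State → ℕ → List (List ℕ)
  language σ zero    = [] ∷ []
  language σ (suc n) = concatMap (λ (x , σ′) → map (x ∷_) (language σ′ n)) (moves σ)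

  count : State → ℕ → ℕ
  count σ zero    = 1
  count σ (suc n) = sum (map (λ (_ , σ′) → count σ′ n) (moves σ))

  length-language : ∀ σ n → length (language σ n) ≡ count σ n
  length-language σ zero    = refl
  length-language σ (suc n) = go (moves σ)
    where
    go : ∀ ms → length (concatMap (λ (x , σ′) → map (x ∷_) (language σ′ n)) ms) ≡
                sum (map (λ (_ , σ′) → count σ′ n) ms)
    go []              = refl
    go ((x , σ′) ∷ ms) = trans (List.length-++ (map (x ∷_) (language σ′ n)))
      (cong₂ _+_ (trans (List.length-map (x ∷_) (language σ′ n)) (length-language σ′ n)) (go ms))

  -- Since the letters of the moves increase strictly, the parts of the concatenation have different
  -- first letters and are disjoint.
  language-unique : (∀ σ → AllPairs (_<_ on proj₁) (moves σ)) → ∀ σ n → Unique (language σ n)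
  language-unique increasing σ zero    = [] ∷ []
  language-unique increasing σ (suc n) = Unique.concat⁺
    (All.map⁺ (All.universal
      (λ (x , σ′) → Unique.map⁺ List.∷-injectiveʳ (language-unique increasing σ′ n)) (moves σ)))
    (AllPairs.map⁺ (AllPairs.map disjoint (increasing σ)))
    where
    disjoint : ∀ {m m′ : ℕ × State} → proj₁ m < proj₁ m′ →
      Disjoint (map (proj₁ m ∷_) (language (proj₂ m) n)) (map (proj₁ m′ ∷_) (language (proj₂ m′) n))
    disjoint x<y (w∈ , w∈′)
      with _ , _ , refl ← ∈-map⁻ _ w∈ | _ , _ , refl ← ∈-map⁻ _ w∈′ = <-irrefl refl x<y

  -- A family of predicates that holds of the empty word and follows the moves in both directions is
  -- membership in the language, by induction on the length.
  module _ (P : State → List ℕ → Set)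
           (P-[] : ∀ σ → P σ [])
           (P-∷⁻ : ∀ σ {x w} → P σ (x ∷ w) → ∃ λ σ′ → (x , σ′) ∈ moves σ × P σ′ w)
           (P-∷⁺ : ∀ σ {x w σ′} → (x , σ′) ∈ moves σ → P σ′ w → P σ (x ∷ w)) where

    ∈-language⁺ : ∀ σ w → P σ w → w ∈ language σ (length w)
    ∈-language⁺ σ []      p = here refl
    ∈-language⁺ σ (x ∷ w) p with σ′ , m , q ← P-∷⁻ σ p =
      ∈-concatMap⁺ _ (lose m (∈-map⁺ (x ∷_) (∈-language⁺ σ′ w q)))

    ∈-language⁻ : ∀ σ n {w} → w ∈ language σ n → length w ≡ n × P σ w
    ∈-language⁻ σ zero    (here refl) = refl , P-[] σ
    ∈-language⁻ σ (suc n) w∈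
      with (x , σ′) , m , w∈′ ← find (∈-concatMap⁻ _ {xs = moves σ} w∈)
      with v , v∈ , refl ← ∈-map⁻ (x ∷_) w∈′
      with refl , p ← ∈-language⁻ σ′ n v∈ = refl , P-∷⁺ σ m p

-- The automaton for sequences avoiding 021 and τ

-- The maximum of the entries read so far is 2 + k in P k, Q k and T k d, and the number
-- of ascents exceeds the maximum by d in Z d, O d and T k d.
--   ones, P k : zeros followed by a weakly increasing word without zeros;
--   Q k       : as P k, followed by zeros;
--   Z d, O d  : a word in 0 and 1 in which a 0 follows a 1, with last entry 0, resp. 1;
--   T k d     : some x 0 y with 0 < x < y has been read.
data State : Set where
  start zeros ones : State
  Z O   : (d : ℕ) → State
  P Q   : (k : ℕ) → State
  T     : (k d : ℕ) → State

-- A rise to `2 + (k + j)` from a word with `1 + (k + d)` ascents adds one ascent. The bound on the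
-- new letter is then `j ≤ d`, and the new slack is `d ∸ j`.
climb : ℕ → ℕ → ℕ → ℕ × State
climb k d j = 2 + (k + j) , T (k + j) (d ∸ j)

climbs : ℕ → ℕ → List (ℕ × State)
climbs k d = applyUpTo (climb k d) (suc d)

module Counting (stay : ℕ → ℕ) where

  -- In `ones`, `P k` and `Q k` the slack is 0, so the maximum can rise only by one. After a 0,
  -- repeating the maximum is an ascent: `Q k` passes to slack 1 and `Z d` to slack `suc d`.
  moves : State → List (ℕ × State)
  moves start   = (0 , zeros) ∷ []
  moves zeros   = (0 , zeros) ∷ (1 , ones) ∷ []
  moves ones    = (0 , Z 0) ∷ (1 , ones) ∷ (2 , P 0) ∷ []
  moves (P k)   = (0 , Q k) ∷ (2 + k , P k) ∷ (3 + k , P (suc k)) ∷ []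
  moves (Q k)   = (0 , Q k) ∷ (2 + k , T k 1) ∷ (3 + k , T (suc k) 0) ∷ []
  moves (Z d)   = (0 , Z d) ∷ (1 , O (suc d)) ∷ climbs 0 d
  moves (O d)   = (0 , Z d) ∷ (1 , O d) ∷ climbs 0 d
  moves (T k d) = (stay (2 + k) , T k d) ∷ climbs (suc k) d

  open Automaton moves public

  increasing : (∀ m → stay m ≤ m) → ∀ σ → AllPairs (_<_ on proj₁) (moves σ)
  increasing stay≤ = go
    where
    climbs-increasing : ∀ k d → AllPairs (_<_ on proj₁) (climbs k d)
    climbs-increasing k d = AllPairs.applyUpTo⁺₁ (climb k d) (suc d)
      λ i<j _ → +-monoʳ-< 2 (+-monoʳ-< k i<j)

    below-climbs : ∀ {x} k d → x < 2 + k → All (λ m → x < proj₁ m) (climbs k d)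
    below-climbs k d x< = All.applyUpTo⁺₂ (climb k d) (suc d) λ j → ≤-trans x< (+-monoʳ-≤ 2 (m≤m+n k j))

    go : ∀ σ → AllPairs (_<_ on proj₁) (moves σ)
    go start   = [] ∷ []
    go zeros   = (z<s ∷ []) ∷ [] ∷ []
    go ones    = (z<s ∷ z<s ∷ []) ∷ (n<1+n 1 ∷ []) ∷ [] ∷ []
    go (P k)   = (z<s ∷ z<s ∷ []) ∷ (n<1+n _ ∷ []) ∷ [] ∷ []
    go (Q k)   = (z<s ∷ z<s ∷ []) ∷ (n<1+n _ ∷ []) ∷ [] ∷ []
    go (Z d)   = (z<s ∷ below-climbs 0 d z<s) ∷ below-climbs 0 d (n<1+n 1) ∷ climbs-increasing 0 d
    go (O d)   = (z<s ∷ below-climbs 0 d z<s) ∷ below-climbs 0 d (n<1+n 1) ∷ climbs-increasing 0 d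
    go (T k d) = below-climbs (suc k) d (s≤s (stay≤ (2 + k))) ∷ climbs-increasing (suc k) d

  -- Recurrences for the numbers of readable words.

  Σ≤ : (ℕ → ℕ) → ℕ → ℕ
  Σ≤ φ zero    = φ 0
  Σ≤ φ (suc d) = φ (suc d) + Σ≤ φ d

  t u z o : ℕ → ℕ → ℕ
  t d n = count (T 0 d) n
  u d n = Σ≤ (λ e → t e n) d
  z d n = count (Z d) n
  o d n = count (O d) n

  sum-applyUpTo : ∀ n (m : ℕ → ℕ × State) φ d → (∀ j → count (proj₂ (m j)) n ≡ φ (d ∸ j)) →
    sum (map (λ (_ , σ) → count σ n) (applyUpTo m (suc d))) ≡ Σ≤ φ d
  sum-applyUpTo n m φ zero    eq = trans (+-identityʳ _) (eq 0)
  sum-applyUpTo n m φ (suc d) eq = cong₂ _+_ (eq 0) (sum-applyUpTo n (m ∘ suc) φ d (eq ∘ suc))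

  -- `k` affects the letters and the maxima of the targets, but neither the number of moves nor the
  -- slacks.
  count-T : ∀ k d n → count (T k d) n ≡ t d n
  count-climbs : ∀ k d n → sum (map (λ (_ , σ) → count σ n) (climbs k d)) ≡ u d n

  count-T k d zero    = refl
  count-T k d (suc n) = cong₂ _+_ (count-T k d n)
    (trans (count-climbs (suc k) d n) (sym (count-climbs 1 d n)))

  count-climbs k d n = sum-applyUpTo n (climb k d) (λ e → t e n) d
    λ j → count-T (k + j) (d ∸ j) n

  t-suc : ∀ d n → t d (suc n) ≡ t d n + u d n
  t-suc d n = cong (λ r → t d n + r) (count-climbs 1 d n)

  z-suc : ∀ d n → z d (suc n) ≡ z d n + (o (suc d) n + u d n)
  z-suc d n = cong (λ r → z d n + (o (suc d) n + r)) (count-climbs 0 d n)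

  o-suc : ∀ d n → o d (suc n) ≡ z d n + (o d n + u d n)
  o-suc d n = cong (λ r → z d n + (o d n + r)) (count-climbs 0 d n)

  -- `Q k` counts like `T k 1`: its loop on 0 replaces the loop on `stay`, and its two rises leave
  -- slack 1 and 0, as the two climbs do.
  count-Q : ∀ k n → count (Q k) n ≡ t 1 n
  count-Q k zero    = refl
  count-Q k (suc n) = begin
    count (Q k) n + (count (T k 1) n + (count (T (suc k) 0) n + 0))
      ≡⟨ cong₂ _+_ (count-Q k n) (cong₂ _+_ (count-T k 1 n) (trans (+-identityʳ _) (count-T (suc k) 0 n))) ⟩
    t 1 n + u 1 n
      ≡⟨ t-suc 1 n ⟨
    t 1 (suc n) ∎
    where open ≡-Reasoning

  count-P : ∀ k n → count (P k) n ≡ count (P 0) n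
  count-P k zero    = refl
  count-P k (suc n) = cong₂ _+_ (trans (count-Q k n) (sym (count-Q 0 n)))
    (cong₂ _+_ (count-P k n) (cong (_+ 0) (trans (count-P (suc k) n) (sym (count-P 1 n)))))

  p-suc : ∀ n → count (P 0) (suc n) ≡ t 1 n + (count (P 0) n + count (P 0) n)
  p-suc n = cong₂ _+_ (count-Q 0 n)
    (cong (λ r → count (P 0) n + r) (trans (+-identityʳ _) (count-P 1 n)))

  -- In terms of generating functions in x, f (suc d) = (1 - x)/(1 - 2x) f d.
  Geometric : (ℕ → ℕ → ℕ) → ℕ → ℕ → Set
  Geometric f d n = f (suc d) (suc n) + f d n ≡ f (suc d) n + f (suc d) n + f d (suc n)

  -- As `u (suc d) n` is `t (suc d) n + u d n`, the recurrences for `suc d` and `d` share the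
  -- summand `u d n`.
  t-geometric : ∀ d n → Geometric t d n
  t-geometric d n rewrite t-suc (suc d) n | t-suc d n = identity (t (suc d) n) (u d n) (t d n)
    where
    identity : ∀ a b c → a + (a + b) + c ≡ a + a + (c + b)
    identity = ℕ-RingSolver.solve-∀

  +-geometric : ∀ f g d n → Geometric f d n → Geometric g d n →
    Geometric (λ d n → f d n + g d n) d n
  +-geometric f g d n f-geo g-geo = trans
    (interchange (f (suc d) (suc n)) (g (suc d) (suc n)) (f d n) (g d n))
    (trans (cong₂ _+_ f-geo g-geo)
      (rearrange (f (suc d) n) (f d (suc n)) (g (suc d) n) (g d (suc n))))
    where
    interchange : ∀ a a′ b b′ → a + a′ + (b + b′) ≡ a + b + (a′ + b′)
    interchange = ℕ-RingSolver.solve-∀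
    rearrange : ∀ c e c′ e′ → c + c + e + (c′ + c′ + e′) ≡ (c + c′) + (c + c′) + (e + e′)
    rearrange = ℕ-RingSolver.solve-∀

  -- Termwise from `t-geometric`. The term `t 0` has no predecessor; it is balanced by the doubling
  -- `t 0 (suc n) ≡ t 0 n + t 0 n`.
  u-geometric : ∀ d n → Geometric u d n
  u-geometric zero    n = trans (rearrange (t 1 (suc n)) (t 0 (suc n)) (t 0 n))
    (trans (cong₂ _+_ (t-geometric 0 n) (t-suc 0 n)) (identity (t 1 n) (t 0 n) (t 0 (suc n))))
    where
    rearrange : ∀ a b c → a + b + c ≡ a + c + b
    rearrange = ℕ-RingSolver.solve-∀
    identity : ∀ a b c → a + a + c + (b + b) ≡ a + b + (a + b) + c
    identity = ℕ-RingSolver.solve-∀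
  u-geometric (suc d) n = +-geometric (λ d → t (suc d)) u d n (t-geometric (suc d) n) (u-geometric d n)

  -- Joint induction on `n` for all `d` at once, as `Z d` leads to `O (suc d)`. The relation is
  -- linear, so it passes through the recurrences.
  z-geometric : ∀ d n → Geometric z d n
  o-geometric : ∀ d n → Geometric o d n

  z-geometric d zero    = trans (cong (_+ 1) (z-suc (suc d) 0))
    (trans (identity (u d 0)) (sym (cong (λ r → 2 + r) (z-suc d 0))))
    where
    identity : ∀ v → 1 + (1 + (1 + v)) + 1 ≡ 2 + (1 + (1 + v))
    identity = ℕ-RingSolver.solve-∀
  z-geometric d (suc n) = trans (cong₂ _+_ (z-suc (suc d) (suc n)) (z-suc d n))
    (trans (+-geometric z (λ d n → o (suc d) n + u d n) d n (z-geometric d n)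
             (+-geometric (λ d → o (suc d)) u d n (o-geometric (suc d) n) (u-geometric d n)))
      (sym (cong₂ (λ r s → r + r + s) (z-suc (suc d) n) (z-suc d (suc n)))))

  o-geometric d zero    = trans (cong (_+ 1) (o-suc (suc d) 0))
    (trans (identity (u d 0)) (sym (cong (λ r → 2 + r) (o-suc d 0))))
    where
    identity : ∀ v → 1 + (1 + (1 + v)) + 1 ≡ 2 + (1 + (1 + v))
    identity = ℕ-RingSolver.solve-∀
  o-geometric d (suc n) = trans (cong₂ _+_ (o-suc (suc d) (suc n)) (o-suc d n))
    (trans (+-geometric z (λ d n → o d n + u d n) d n (z-geometric d n)
             (+-geometric o u d n (o-geometric d n) (u-geometric d n)))
      (sym (cong₂ (λ r s → r + r + s) (o-suc (suc d) n) (o-suc d (suc n)))))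

  -- This closes the system: `z 0` needs `o 1`, whose own recurrence would need `z 1`, and so on.
  -- The geometric relation leads back to `o 0 (suc n)`, and after expansion `o 0 n` cancels.
  o₁-suc : ∀ n → o 1 (suc n) ≡ o 1 n + o 1 n + (z 0 n + t 0 n)
  o₁-suc n = +-cancelʳ-≡ (o 0 n) _ _ (trans (o-geometric 0 n)
    (trans (cong (λ r → o 1 n + o 1 n + r) (o-suc 0 n)) (identity (o 1 n + o 1 n) (z 0 n) (o 0 n) (t 0 n))))
    where
    identity : ∀ a b c d → a + (b + (c + d)) ≡ a + (b + d) + c
    identity = ℕ-RingSolver.solve-∀

  -- Both sides grow by the same amount from `n` to `suc n`. The relation eliminates `count ones`,
  -- which would be a seventh unknown.
  ones-balance : ∀ n → count ones n + (z 0 n + t 1 n) ≡ o 1 n + (count (P 0) n + t 0 n)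
  ones-balance zero    = refl
  ones-balance (suc n) = begin
    z 0 n + (count ones n + (count (P 0) n + 0)) + (z 0 (suc n) + t 1 (suc n))
      ≡⟨ cong₂ (λ r s → z 0 n + (count ones n + (count (P 0) n + 0)) + (r + s)) (z-suc 0 n) (t-suc 1 n) ⟩
    z 0 n + (count ones n + (count (P 0) n + 0)) +
      (z 0 n + (o 1 n + t 0 n) + (t 1 n + (t 1 n + t 0 n)))
      ≡⟨ left (count ones n) (z 0 n) (t 1 n) (count (P 0) n) (o 1 n) (t 0 n) ⟩
    (count ones n + (z 0 n + t 1 n)) + (z 0 n + (count (P 0) n + (o 1 n + (t 0 n + (t 1 n + t 0 n)))))
      ≡⟨ cong (_+ (z 0 n + (count (P 0) n + (o 1 n + (t 0 n + (t 1 n + t 0 n)))))) (ones-balance n) ⟩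
    (o 1 n + (count (P 0) n + t 0 n)) + (z 0 n + (count (P 0) n + (o 1 n + (t 0 n + (t 1 n + t 0 n)))))
      ≡⟨ right (z 0 n) (t 1 n) (count (P 0) n) (o 1 n) (t 0 n) ⟩
    o 1 n + o 1 n + (z 0 n + t 0 n) + (t 1 n + (count (P 0) n + count (P 0) n) + (t 0 n + t 0 n))
      ≡⟨ cong₂ _+_ (o₁-suc n) (cong₂ _+_ (p-suc n) (t-suc 0 n)) ⟨
    o 1 (suc n) + (count (P 0) (suc n) + t 0 (suc n)) ∎
    where
    open ≡-Reasoning
    left : ∀ y z t₁ p o t₀ → z + (y + (p + 0)) + (z + (o + t₀) + (t₁ + (t₁ + t₀))) ≡
                             (y + (z + t₁)) + (z + (p + (o + (t₀ + (t₁ + t₀)))))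
    left = ℕ-RingSolver.solve-∀
    right : ∀ z t₁ p o t₀ → (o + (p + t₀)) + (z + (p + (o + (t₀ + (t₁ + t₀))))) ≡
                            o + o + (z + t₀) + (t₁ + (p + p) + (t₀ + t₀))
    right = ℕ-RingSolver.solve-∀

-- Occurrences as sublists

private
  map-suc⁻ : ∀ {m n} (ι : Vec (Fin (suc n)) m) → (∀ j → 0 < toℕ (Vec.lookup ι j)) →
    ∃ λ κ → ι ≡ Vec.map Fin.suc κ
  map-suc⁻ Vec.[]                 0<ι = Vec.[] , refl
  map-suc⁻ (Fin.zero  Vec.∷ ι) 0<ι = contradiction (0<ι Fin.zero) λ ()
  map-suc⁻ (Fin.suc i Vec.∷ ι) 0<ι with κ , refl ← map-suc⁻ ι (0<ι ∘ Fin.suc) = i Vec.∷ κ , refl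

  increasing-suc⁻ : ∀ {m n} (κ : Vec (Fin n) m) →
    StrictlyIncreasing (Vec.map Fin.suc κ) → StrictlyIncreasing κ
  increasing-suc⁻ κ incr j k j<k = s<s⁻¹ (subst₂ Fin._<_
    (Vec.lookup-map j Fin.suc κ) (Vec.lookup-map k Fin.suc κ) (incr j k j<k))

  increasing-suc⁺ : ∀ {m n} (κ : Vec (Fin n) m) →
    StrictlyIncreasing κ → StrictlyIncreasing (Vec.map Fin.suc κ)
  increasing-suc⁺ κ incr j k j<k = subst₂ Fin._<_
    (sym (Vec.lookup-map j Fin.suc κ)) (sym (Vec.lookup-map k Fin.suc κ)) (s<s (incr j k j<k))

entries : ∀ {m} (π : List ℕ) → Vec (Fin (length π)) m → List ℕ
entries π ι = Vec.toList (Vec.map (lookup π) ι)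

entries-suc : ∀ {m} x (π : List ℕ) (κ : Vec (Fin (length π)) m) →
  entries (x ∷ π) (Vec.map Fin.suc κ) ≡ entries π κ
entries-suc x π κ = cong Vec.toList (sym (Vec.map-∘ (lookup (x ∷ π)) Fin.suc κ))

entries-⊆ : ∀ {m} π (ι : Vec (Fin (length π)) m) → StrictlyIncreasing ι → entries π ι ⊆ π
entries-⊆ π       Vec.[]                incr = minimum π
entries-⊆ (x ∷ π) (Fin.zero Vec.∷ ι) incr
  with κ , refl ← map-suc⁻ ι (λ j → incr Fin.zero (Fin.suc j) z<s) =
  refl ∷ subst (_⊆ π) (sym (entries-suc x π κ))
    (entries-⊆ π κ (increasing-suc⁻ κ (λ j k j<k → incr (Fin.suc j) (Fin.suc k) (s<s j<k))))
entries-⊆ (x ∷ π) (Fin.suc i Vec.∷ ι) incr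
  with κ , refl ← map-suc⁻ ι (λ j → ≤-<-trans z≤n (incr Fin.zero (Fin.suc j) z<s)) =
  x ∷ʳ subst (_⊆ π) (sym (entries-suc x π (i Vec.∷ κ)))
    (entries-⊆ π (i Vec.∷ κ) (increasing-suc⁻ (i Vec.∷ κ) incr))

module _ (f : ℕ → ℕ) where

  positions : ∀ τ {π} → map f τ ⊆ π → ∃ λ (ι : Vec (Fin (length π)) (length τ)) →
    StrictlyIncreasing ι × (∀ j → lookup π (Vec.lookup ι j) ≡ f (lookup τ j))
  positions []      p          = Vec.[] , (λ ()) , λ ()
  positions (t ∷ τ) (y ∷ʳ p)
    with ι , incr , eq ← positions (t ∷ τ) p =
    Vec.map Fin.suc ι , increasing-suc⁺ ι incr ,
    λ j → trans (cong (lookup (y ∷ _)) (Vec.lookup-map j Fin.suc ι)) (eq j)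
  positions (t ∷ τ) {π = y ∷ π} (refl ∷ p)
    with ι , incr , eq ← positions τ p = Fin.zero Vec.∷ Vec.map Fin.suc ι , incr′ , eq′
    where
    incr′ : StrictlyIncreasing (Fin.zero Vec.∷ Vec.map Fin.suc ι)
    incr′ Fin.zero    (Fin.suc k) _     =
      subst (λ i → 0 < toℕ i) (sym (Vec.lookup-map k Fin.suc ι)) z<s
    incr′ (Fin.suc j) (Fin.suc k) j<k = increasing-suc⁺ ι incr j k (s<s⁻¹ j<k)
    eq′ : ∀ j → lookup (f t ∷ π) (Vec.lookup (Fin.zero Vec.∷ Vec.map Fin.suc ι) j) ≡ f (lookup (t ∷ τ) j)
    eq′ Fin.zero    = refl
    eq′ (Fin.suc j) = trans (cong (lookup (f t ∷ π)) (Vec.lookup-map j Fin.suc ι)) (eq j)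

  module _ (f-mono : ∀ {m n} → m < n → f m < f n) where

    <-reflects : ∀ {m n} → f m < f n → m < n
    <-reflects {m} {n} fm<fn with <-cmp m n
    ... | tri< m<n _ _  = m<n
    ... | tri≈ _ refl _ = contradiction fm<fn (<-irrefl refl)
    ... | tri> _ _ n<m  = contradiction fm<fn (<-asym (f-mono n<m))

    injective : ∀ {m n} → f m ≡ f n → m ≡ n
    injective {m} {n} fm≡fn with <-cmp m n
    ... | tri< m<n _ _ = contradiction (f-mono m<n) (<-irrefl fm≡fn)
    ... | tri≈ _ m≡n _ = m≡n
    ... | tri> _ _ n<m = contradiction (f-mono n<m) (<-irrefl (sym fm≡fn))

    -- A strictly increasing `f` preserves and reflects both order and equality, so a copy of
    -- `map f τ` is order-isomorphic to `τ`.
    contains-image : ∀ τ {π} → map f τ ⊆ π → Contains π τ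
    contains-image τ p with ι , incr , eq ← positions τ p = ι , incr , λ j k →
      mk⇔ (<-reflects ∘ subst₂ _<_ (eq j) (eq k)) (subst₂ _<_ (sym (eq j)) (sym (eq k)) ∘ f-mono) ,
      mk⇔ (λ e → injective (trans (sym (eq j)) (trans e (eq k))))
          (λ e → trans (eq j) (trans (cong f e) (sym (eq k))))

-- The increasing map 0 ↦ a, 1 ↦ b, 2 + n ↦ c + n.
threshold : (a b c : ℕ) → ℕ → ℕ
threshold a b c 0             = a
threshold a b c 1             = b
threshold a b c (suc (suc n)) = n + c

threshold-mono : ∀ {a b c} → a < b → b < c → ∀ {m n} → m < n → threshold a b c m < threshold a b c n
threshold-mono a<b b<c {0} {1} _ = a<b
threshold-mono {c = c} a<b b<c {0} {suc (suc n)} _ = <-≤-trans (<-trans a<b b<c) (m≤n+m c n)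
threshold-mono {c = c} a<b b<c {1} {suc (suc n)} _ = <-≤-trans b<c (m≤n+m c n)
threshold-mono a<b b<c {suc m} {1} (s≤s ())
threshold-mono {c = c} a<b b<c {suc (suc m)} {suc (suc n)} m<n = +-monoˡ-< c (s<s⁻¹ (s<s⁻¹ m<n))

contains021⁻ : ∀ {π} → Contains π pattern021 →
  ∃ λ a → ∃₂ λ b c → a < b × b < c × a ∷ c ∷ b ∷ [] ⊆ π
contains021⁻ {π} (ι@(i Vec.∷ j Vec.∷ k Vec.∷ Vec.[]) , incr , iso) =
  lookup π i , lookup π k , lookup π j ,
  Equivalence.from (proj₁ (iso 0F 2F)) z<s ,
  Equivalence.from (proj₁ (iso 2F 1F)) (n<1+n 1) ,
  entries-⊆ π ι incr

contains021⁺ : ∀ {π a b c} → a < b → b < c → a ∷ c ∷ b ∷ [] ⊆ π → Contains π pattern021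
contains021⁺ {a = a} {b} {c} a<b b<c =
  contains-image (threshold a b c) (threshold-mono a<b b<c) pattern021

-- Continuations of ascent sequences

-- `Ascending l m s w`: a 021-avoiding ascent sequence with last entry l, maximum m
-- and s ascents remains one when followed by w.
data Ascending : (l m s : ℕ) → List ℕ → Set where
  []    : ∀ {l m s} → Ascending l m s []
  zero  : ∀ {l m s w} → Ascending 0 m s w → Ascending l m s (0 ∷ w)
  level : ∀ {m s w} → Ascending (suc m) (suc m) s w → Ascending (suc m) (suc m) s (suc m ∷ w)
  rise  : ∀ {l m s x w} → l < x → m ≤ x → x ≤ suc s → Ascending x x (suc s) w →
          Ascending l m s (x ∷ w)

cast-asc : ∀ {l m s s′ w} → s ≡ s′ → Ascending l m s w → Ascending l m s′ w
cast-asc refl a = a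

-- The entries `c` and `b` need not be adjacent. For a word that starts with 0 this is avoidance of
-- 021, the initial 0 serving as the smallest letter.
NoDescent : List ℕ → Set
NoDescent w = ∀ {b c} → 0 < b → b < c → ¬ (c ∷ b ∷ [] ⊆ w)

NoDescent-drop : ∀ {m x w} → NoDescent (m ∷ x ∷ w) → NoDescent (m ∷ w)
NoDescent-drop nd 0<b b<c (_ ∷ʳ p)    = nd 0<b b<c (_ ∷ʳ (_ ∷ʳ p))
NoDescent-drop nd 0<b b<c (refl ∷ p) = nd 0<b b<c (refl ∷ (_ ∷ʳ p))

-- The maximum `m` is prepended to record that no later positive entry is below it.
Ascending⇒NoDescent : ∀ {l m s w} → Ascending l m s w → NoDescent (m ∷ w)
Ascending⇒NoDescent = go
  where
  larger : ∀ {m x w} → m ≤ x → NoDescent (x ∷ w) → NoDescent (m ∷ x ∷ w)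
  larger m≤x nd 0<b b<c (_ ∷ʳ p)              = nd 0<b b<c p
  larger m≤x nd 0<b b<m (refl ∷ (_ ∷ʳ p))   = nd 0<b (<-≤-trans b<m m≤x) (refl ∷ p)
  larger m≤x nd 0<x x<m (refl ∷ (refl ∷ p)) = <-irrefl refl (<-≤-trans x<m m≤x)

  go : ∀ {l m s w} → Ascending l m s w → NoDescent (m ∷ w)
  go []                     0<b b<c (_ ∷ʳ ())
  go []                     0<b b<c (refl ∷ ())
  go (zero a)               0<b b<c (_ ∷ʳ (_ ∷ʳ p))    = go a 0<b b<c (_ ∷ʳ p)
  go (zero a)               0<b ()   (_ ∷ʳ (refl ∷ p))
  go (zero a)               0<b b<c (refl ∷ (_ ∷ʳ p))  = go a 0<b b<c (refl ∷ p)
  go (zero a)               ()   b<c (refl ∷ (refl ∷ p))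
  go (level a)              = larger ≤-refl (go a)
  go (rise _ m≤x _ a)      = larger m≤x (go a)

-- This makes the second letter of an occurrence of 1020 or 1022, known only to be smaller than the
-- first, an actual 0.
NoDescent⇒0 : ∀ {π x y u} → NoDescent π → y < x → x ∷ y ∷ u ⊆ π → y ≡ 0
NoDescent⇒0 {y = zero}  nd y<x p = refl
NoDescent⇒0 {y = suc y} nd y<x p = contradiction (⊆-trans (refl ∷ refl ∷ minimum _) p) (nd z<s y<x)

-- The last entry `l` already read is prepended so that an ascent from it into `w` is counted.
Bounded : (l s : ℕ) → List ℕ → Set
Bounded l s w = ∀ (i : Fin (length w)) → lookup w i ≤ s + asc (l ∷ take (toℕ i) w) + 1

asc-rise : ∀ {l x} → l < x → ∀ u → asc (l ∷ x ∷ u) ≡ suc (asc (x ∷ u))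
asc-rise {l} {x} l<x u with l <ᵇ x | <⇒<ᵇ l<x
... | true | _ = refl

asc-flat : ∀ {l x} → x ≤ l → ∀ u → asc (l ∷ x ∷ u) ≡ asc (x ∷ u)
asc-flat {l} {x} x≤l u with l <ᵇ x in eq
... | false = refl
... | true  = contradiction (<ᵇ⇒< l x (subst Bool.T (sym eq) _)) (≤⇒≯ x≤l)

module _ {l x s s′} (eq : ∀ u → s + asc (l ∷ x ∷ u) ≡ s′ + asc (x ∷ u)) where
  private
    head≡ : s + 0 + 1 ≡ suc s
    head≡ = trans (+-comm (s + 0) 1) (cong suc (+-identityʳ s))

  Bounded-∷⁻ : ∀ {w} → Bounded l s (x ∷ w) → x ≤ suc s × Bounded x s′ w
  Bounded-∷⁻ {w} bd = subst (x ≤_) head≡ (bd Fin.zero) ,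
    λ i → subst (λ r → lookup w i ≤ r + 1) (eq (take (toℕ i) w)) (bd (Fin.suc i))

  Bounded-∷⁺ : ∀ {w} → x ≤ suc s → Bounded x s′ w → Bounded l s (x ∷ w)
  Bounded-∷⁺ x≤ bd Fin.zero = subst (x ≤_) (sym head≡) x≤
  Bounded-∷⁺ {w} x≤ bd (Fin.suc i) =
    subst (λ r → lookup w i ≤ r + 1) (sym (eq (take (toℕ i) w))) (bd i)

rise-eq : ∀ {l x} s → l < x → ∀ u → s + asc (l ∷ x ∷ u) ≡ suc s + asc (x ∷ u)
rise-eq s l<x u = trans (cong (λ r → s + r) (asc-rise l<x u)) (+-suc s _)

flat-eq : ∀ {l x} s → x ≤ l → ∀ u → s + asc (l ∷ x ∷ u) ≡ s + asc (x ∷ u)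
flat-eq s x≤l u = cong (λ r → s + r) (asc-flat x≤l u)

Ascending⇒Bounded : ∀ {l m s w} → m ≤ suc s → Ascending l m s w → Bounded l s w
Ascending⇒Bounded m≤ []                   ()
Ascending⇒Bounded {l} m≤ (zero a)         = Bounded-∷⁺ (flat-eq {l} _ z≤n) z≤n (Ascending⇒Bounded m≤ a)
Ascending⇒Bounded m≤ (level a)            = Bounded-∷⁺ (flat-eq _ ≤-refl) m≤ (Ascending⇒Bounded m≤ a)
Ascending⇒Bounded m≤ (rise l<x m≤x x≤ a) =
  Bounded-∷⁺ (rise-eq _ l<x) x≤ (Ascending⇒Bounded (m≤n⇒m≤1+n x≤) a)

-- The invariant `l ≡ 0 ⊎ l ≡ m` ensures that a positive entry which is neither an ascent nor below
-- the maximum repeats the maximum.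
Bounded⇒Ascending : ∀ l m s w → l ≡ 0 ⊎ l ≡ m → Bounded l s w → NoDescent (m ∷ w) → Ascending l m s w
Bounded⇒Ascending l m s []          l∈ bd nd = []
Bounded⇒Ascending l m s (zero ∷ w)  l∈ bd nd = zero
  (Bounded⇒Ascending 0 m s w (inj₁ refl) (proj₂ (Bounded-∷⁻ (flat-eq {l} s z≤n) bd)) (NoDescent-drop nd))
Bounded⇒Ascending l m s (suc x ∷ w) l∈ bd nd with l <? suc x | suc x <? m
... | _       | yes x<m = contradiction (refl ∷ (refl ∷ minimum w)) (nd z<s x<m)
... | yes l<x | no x≮m with x≤ , bd′ ← Bounded-∷⁻ (rise-eq s l<x) bd =
  rise l<x (≮⇒≥ x≮m) x≤
    (Bounded⇒Ascending (suc x) (suc x) (suc s) w (inj₂ refl) bd′ (λ 0<b b<c p → nd 0<b b<c (m ∷ʳ p)))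
... | no l≮x  | no x≮m with l∈
...   | inj₁ refl = contradiction z<s l≮x
...   | inj₂ refl with refl ← ≤-antisym (≮⇒≥ l≮x) (≮⇒≥ x≮m) =
  level (Bounded⇒Ascending l l s w (inj₂ refl) (proj₂ (Bounded-∷⁻ (flat-eq {l} s ≤-refl) bd)) (NoDescent-drop nd))

NoDescent⇒Avoids021 : ∀ {w} → NoDescent w → Avoids w pattern021
NoDescent⇒Avoids021 nd occ with _ , _ , _ , a<b , b<c , p ← contains021⁻ occ =
  nd (≤-<-trans z≤n a<b) b<c (∷ˡ⁻ p)

Avoids021⇒NoDescent : ∀ {w} → Avoids (0 ∷ w) pattern021 → NoDescent (0 ∷ w)
Avoids021⇒NoDescent av 0<b b<c (_ ∷ʳ p) = av (contains021⁺ 0<b b<c (refl ∷ p))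
Avoids021⇒NoDescent av 0<b ()   (refl ∷ p)

-- Residual patterns

module Residual (g : ℕ → ℕ) where

  -- What must be avoided after nothing, `x`, or `x 0` has been read. The first positive entry of an
  -- ascent sequence is 1, so `x` can be taken to be 1 and `x < y` becomes `1 < y`.
  Avoids₀ Avoids₁ Avoids₂ : List ℕ → Set
  Avoids₀ w = ∀ {x y} → 0 < x → x < y → ¬ (x ∷ 0 ∷ y ∷ g y ∷ [] ⊆ w)
  Avoids₁ w = ∀ {y} → 1 < y → ¬ (0 ∷ y ∷ g y ∷ [] ⊆ w)
  Avoids₂ w = ∀ {y} → 1 < y → ¬ (y ∷ g y ∷ [] ⊆ w)

  drop₁ : ∀ {x w} → Avoids₁ (x ∷ w) → Avoids₁ w
  drop₁ av 1<y p = av 1<y (_ ∷ʳ p)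

  drop₂ : ∀ {x w} → Avoids₂ (x ∷ w) → Avoids₂ w
  drop₂ av 1<y p = av 1<y (_ ∷ʳ p)

  small₂ : ∀ {x w} → x ≤ 1 → Avoids₂ w → Avoids₂ (x ∷ w)
  small₂ x≤1 av 1<y (_ ∷ʳ p)    = av 1<y p
  small₂ x≤1 av 1<x (refl ∷ p) = <⇒≱ 1<x x≤1

  positive₁ : ∀ {x w} → 0 < x → Avoids₁ w → Avoids₁ (x ∷ w)
  positive₁ 0<x av 1<y (_ ∷ʳ p)    = av 1<y p
  positive₁ ()  av 1<y (refl ∷ p)

  zero₁⁺ : ∀ {w} → Avoids₂ w → Avoids₁ (0 ∷ w)
  zero₁⁺ av 1<y (_ ∷ʳ p)    = av 1<y (∷ˡ⁻ p)
  zero₁⁺ av 1<y (refl ∷ p) = av 1<y p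

  zero₁⁻ : ∀ {w} → Avoids₁ (0 ∷ w) → Avoids₂ w
  zero₁⁻ av 1<y p = av 1<y (refl ∷ p)

  zero₀⁺ : ∀ {w} → Avoids₀ w → Avoids₀ (0 ∷ w)
  zero₀⁺ av 0<x x<y (_ ∷ʳ p)    = av 0<x x<y p
  zero₀⁺ av ()  x<y (refl ∷ p)

  zero₀⁻ : ∀ {w} → Avoids₀ (0 ∷ w) → Avoids₀ w
  zero₀⁻ av 0<x x<y p = av 0<x x<y (_ ∷ʳ p)

  one₀⁺ : ∀ {w} → Avoids₁ w → Avoids₀ (1 ∷ w)
  one₀⁺ av 0<x x<y (_ ∷ʳ p)    = av (≤-<-trans 0<x x<y) (∷ˡ⁻ p)
  one₀⁺ av 0<x x<y (refl ∷ p) = av x<y p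

  one₀⁻ : ∀ {w} → Avoids₀ (1 ∷ w) → Avoids₁ w
  one₀⁻ av 1<y p = av z<s 1<y (refl ∷ p)

-- In a sequence avoiding 021, an occurrence of τ is a subsequence x 0 y (g y) with
-- 0 < x < y.  Once x 0 m has been read, where 0 < x < m and m is the maximum so far, a
-- next entry that is not above m is 0 or m; one of these is the forbidden g m, the other
-- is `stay m`.
record Tame (τ : List ℕ) (stay g : ℕ → ℕ) : Set where
  open Residual g
  field
    contains⁻ : ∀ {π} → NoDescent π → Contains π τ →
                ∃₂ λ x y → 0 < x × x < y × x ∷ 0 ∷ y ∷ g y ∷ [] ⊆ π
    contains⁺ : ∀ {π x y} → 0 < x → x < y → x ∷ 0 ∷ y ∷ g y ∷ [] ⊆ π → Contains π τ
    stay≤     : ∀ m → stay m ≤ m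
    stay⁺     : ∀ {m s w} → 1 < m → Ascending m m s w → Avoids₂ (m ∷ w) →
                Ascending m m s (stay m ∷ w) × Avoids₂ (m ∷ stay m ∷ w)
    move⁻     : ∀ {m s x w} → 1 < m → Ascending m m s (x ∷ w) → Avoids₂ (m ∷ x ∷ w) →
                (x ≡ stay m × Ascending m m s w × Avoids₂ (m ∷ w)) ⊎
                (m < x × x ≤ suc s × Ascending x x (suc s) w)
    rise⁺     : ∀ {m s x w} → 1 < m → m < x → Ascending x x s w → Avoids₂ (x ∷ w) →
                Avoids₂ (m ∷ x ∷ w)

-- Correctness of the automaton.

module _ {τ : List ℕ} {stay g : ℕ → ℕ} (tame : Tame τ stay g) where
  open Tame tame
  open Residual g
  open Counting stay

  -- In `T k d` the maximum is prepended as a possible `y`. It also stands for the last entry after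
  -- a `stay` equal to 0, since there it cannot occur again.
  Accepts : State → List ℕ → Set
  Accepts start   w = IsAscentSequence w × Avoids w pattern021 × Avoids w τ
  Accepts zeros   w = Ascending 0 0 0 w × Avoids₀ w
  Accepts ones    w = Ascending 1 1 1 w × Avoids₁ w
  Accepts (P k)   w = Ascending (2 + k) (2 + k) (2 + k) w × Avoids₁ w
  Accepts (Q k)   w = Ascending 0 (2 + k) (2 + k) w × Avoids₂ w
  Accepts (Z d)   w = Ascending 0 1 (suc d) w × Avoids₂ w
  Accepts (O d)   w = Ascending 1 1 (suc d) w × Avoids₂ w
  Accepts (T k d) w = Ascending (2 + k) (2 + k) (2 + k + d) w × Avoids₂ (2 + k ∷ w)

  accepts-[] : ∀ σ → Accepts σ []
  accepts-[] start   = isAscentSequence (λ ()) (λ ()) ,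
    (λ (ι , _) → no-position (Vec.head ι)) , λ occ → no-sublist (contains⁻ (λ _ _ ()) occ)
    where
    no-position : ¬ Fin 0
    no-position ()
    no-sublist : ¬ (∃₂ λ x y → 0 < x × x < y × x ∷ 0 ∷ y ∷ g y ∷ [] ⊆ [])
    no-sublist (_ , _ , _ , _ , ())
  accepts-[] zeros   = [] , λ _ _ ()
  accepts-[] ones    = [] , λ _ ()
  accepts-[] (P k)   = [] , λ _ ()
  accepts-[] (Q k)   = [] , λ _ ()
  accepts-[] (Z d)   = [] , λ _ ()
  accepts-[] (O d)   = [] , λ _ ()
  accepts-[] (T k d) = [] , λ { _ (_ ∷ʳ ()) ; _ (refl ∷ ()) }

  slack : ∀ k {d j} → j ≤ d → 2 + (k + j) + (d ∸ j) ≡ 2 + (k + d)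
  slack k {d} {j} j≤d = cong (λ r → 2 + r) (trans (+-assoc k j (d ∸ j)) (cong (λ r → k + r) (m+[n∸m]≡n j≤d)))

  climbs⁻ : ∀ k d {x w} → 2 + k ≤ x → x ≤ 2 + (k + d) → Ascending x x (2 + (k + d)) w →
    Avoids₂ (x ∷ w) → ∃ λ σ → (x , σ) ∈ climbs k d × Accepts σ w
  climbs⁻ k d {w = w} ≤x x≤ a av with j , refl ← m≤n⇒∃[o]m+o≡n ≤x =
    T (k + j) (d ∸ j) , ∈-applyUpTo⁺ (climb k d) (s≤s j≤d) ,
    cast-asc (sym (slack k j≤d)) a , av
    where
    j≤d : j ≤ d
    j≤d = +-cancelˡ-≤ (2 + k) j d x≤

  climbs⁺ : ∀ k d {x w σ} → (x , σ) ∈ climbs k d → Accepts σ w →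
    2 + k ≤ x × x ≤ 2 + (k + d) × Ascending x x (2 + (k + d)) w × Avoids₂ (x ∷ w)
  climbs⁺ k d {w = w} m acc with j , j<1+d , refl ← ∈-applyUpTo⁻ (climb k d) m =
    let a , av = acc in
    m≤m+n (2 + k) j , +-monoʳ-≤ (2 + k) (s≤s⁻¹ j<1+d) ,
    cast-asc (slack k (s≤s⁻¹ j<1+d)) a , av

  accepts-∷⁻ : ∀ σ {x w} → Accepts σ (x ∷ w) → ∃ λ σ′ → (x , σ′) ∈ moves σ × Accepts σ′ w
  accepts-∷⁻ start {x} {w} (isAscentSequence first later , av , av′)
    with refl ← first Fin.zero refl =
    zeros , here refl ,
    Bounded⇒Ascending 0 0 0 w (inj₁ refl) (λ i → later (Fin.suc i) z<s) (Avoids021⇒NoDescent av) ,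
    λ 0<x x<y p → av′ (contains⁺ 0<x x<y (_ ∷ʳ p))
  accepts-∷⁻ zeros (zero a , av)                              = zeros , here refl , a , zero₀⁻ av
  accepts-∷⁻ zeros (rise z<s _ (s≤s z≤n) a , av)             = ones , there (here refl) , a , one₀⁻ av
  accepts-∷⁻ ones (zero a , av)                               = Z 0 , here refl , a , zero₁⁻ av
  accepts-∷⁻ ones (level a , av)                              = ones , there (here refl) , a , drop₁ av
  accepts-∷⁻ ones (rise (s≤s z<s) _ (s≤s (s≤s z≤n)) a , av) =
    P 0 , there (there (here refl)) , a , drop₁ av
  accepts-∷⁻ (P k) (zero a , av)                              = Q k , here refl , a , zero₁⁻ av
  accepts-∷⁻ (P k) (level a , av)                             = P k , there (here refl) , a , drop₁ av
  -- With slack 0 the bounds on the new entry meet at `3 + k`.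
  accepts-∷⁻ (P k) (rise l<x _ x≤ a , av) with refl ← ≤-antisym x≤ l<x =
    P (suc k) , there (there (here refl)) , a , drop₁ av
  accepts-∷⁻ (Q k) (zero a , av)                              = Q k , here refl , a , drop₂ av
  accepts-∷⁻ (Q k) {w = w} (rise _ m≤x x≤ a , av) with m≤n⇒m<n∨m≡n m≤x
  ... | inj₂ refl = T k 1 , there (here refl) ,
    cast-asc (+-comm 1 (2 + k)) a , av
  ... | inj₁ m<x with refl ← ≤-antisym x≤ m<x = T (suc k) 0 , there (there (here refl)) ,
    cast-asc (sym (+-identityʳ (3 + k))) a , av
  accepts-∷⁻ (Z d) (zero a , av)                              = Z d , here refl , a , drop₂ av
  accepts-∷⁻ (Z d) {suc zero} (rise _ _ _ a , av)             = O (suc d) , there (here refl) , a , drop₂ av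
  accepts-∷⁻ (Z d) {suc (suc x)} (rise _ _ x≤ a , av)
    with σ , m , acc ← climbs⁻ 0 d (s≤s (s≤s z≤n)) x≤ a av = σ , there (there m) , acc
  accepts-∷⁻ (O d) (zero a , av)                              = Z d , here refl , a , drop₂ av
  accepts-∷⁻ (O d) (level a , av)                             = O d , there (here refl) , a , drop₂ av
  accepts-∷⁻ (O d) (rise 1<x _ x≤ a , av)
    with σ , m , acc ← climbs⁻ 0 d 1<x x≤ a av = σ , there (there m) , acc
  accepts-∷⁻ (T k d) (a , av) with move⁻ (s≤s z<s) a av
  ... | inj₁ (refl , a′ , av′) = T k d , here refl , a′ , av′
  ... | inj₂ (m<x , x≤ , a′)
    with σ , m , acc ← climbs⁻ (suc k) d m<x x≤ a′ (drop₂ av) = σ , there m , acc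

  accepts-∷⁺ : ∀ σ {x w σ′} → (x , σ′) ∈ moves σ → Accepts σ′ w → Accepts σ (x ∷ w)
  accepts-∷⁺ start {w = w} (here refl) (a , av) =
    isAscentSequence (λ { Fin.zero _ → refl }) later ,
    NoDescent⇒Avoids021 (Ascending⇒NoDescent a) , avoids
    where
    later : ∀ i → 0 < toℕ i → lookup (0 ∷ w) i ≤ asc (take (toℕ i) (0 ∷ w)) + 1
    later (Fin.suc i) _ = Ascending⇒Bounded z≤n a i
    avoids : Avoids (0 ∷ w) τ
    avoids occ with x , y , 0<x , x<y , p ← contains⁻ (Ascending⇒NoDescent a) occ =
      zero₀⁺ av 0<x x<y p
  accepts-∷⁺ zeros (here refl)                 (a , av) = zero a , zero₀⁺ av
  accepts-∷⁺ zeros (there (here refl))         (a , av) = rise z<s z≤n ≤-refl a , one₀⁺ av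
  accepts-∷⁺ ones  (here refl)                 (a , av) = zero a , zero₁⁺ av
  accepts-∷⁺ ones  (there (here refl))         (a , av) = level a , positive₁ z<s av
  accepts-∷⁺ ones  (there (there (here refl))) (a , av) =
    rise ≤-refl (n≤1+n 1) ≤-refl a , positive₁ z<s av
  accepts-∷⁺ (P k) (here refl)                 (a , av) = zero a , zero₁⁺ av
  accepts-∷⁺ (P k) (there (here refl))         (a , av) = level a , positive₁ z<s av
  accepts-∷⁺ (P k) (there (there (here refl))) (a , av) =
    rise ≤-refl (n≤1+n _) ≤-refl a , positive₁ z<s av
  accepts-∷⁺ (Q k) (here refl)                 (a , av) = zero a , small₂ z≤n av
  accepts-∷⁺ (Q k) {w = w} (there (here refl)) (a , av) =
    rise z<s ≤-refl (n≤1+n _) (cast-asc (+-comm (2 + k) 1) a) , av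
  accepts-∷⁺ (Q k) {w = w} (there (there (here refl))) (a , av) =
    rise z<s (n≤1+n _) ≤-refl (cast-asc (+-identityʳ (3 + k)) a) , av
  accepts-∷⁺ (Z d) (here refl)                 (a , av) = zero a , small₂ z≤n av
  accepts-∷⁺ (Z d) (there (here refl))         (a , av) = rise z<s ≤-refl (s≤s z≤n) a , small₂ ≤-refl av
  accepts-∷⁺ (Z d) (there (there m)) acc with ≤x , x≤ , a , av ← climbs⁺ 0 d m acc =
    rise (≤-trans z<s ≤x) (≤-trans z<s ≤x) x≤ a , av
  accepts-∷⁺ (O d) (here refl)                 (a , av) = zero a , small₂ z≤n av
  accepts-∷⁺ (O d) (there (here refl))         (a , av) = level a , small₂ ≤-refl av
  accepts-∷⁺ (O d) (there (there m)) acc with ≤x , x≤ , a , av ← climbs⁺ 0 d m acc =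
    rise ≤x (≤-trans z<s ≤x) x≤ a , av
  accepts-∷⁺ (T k d) (here refl)               (a , av) = stay⁺ (s≤s z<s) a av
  accepts-∷⁺ (T k d) (there m) acc with ≤x , x≤ , a , av ← climbs⁺ (suc k) d m acc =
    rise ≤x (<⇒≤ ≤x) x≤ a , rise⁺ (s≤s z<s) ≤x a av

-- The patterns 1020 and 1022.

tame1020 : Tame pattern1020 id (const 0)
tame1020 = record
  { contains⁻ = contains⁻
  ; contains⁺ = λ 0<x x<y → contains-image (threshold 0 _ _) (threshold-mono 0<x x<y) pattern1020
  ; stay≤     = λ _ → ≤-refl
  ; stay⁺     = stay⁺
  ; move⁻     = move⁻
  ; rise⁺     = rise⁺
  }
  where
  open Residual (const 0)

  contains⁻ : ∀ {π} → NoDescent π → Contains π pattern1020 →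
    ∃₂ λ x y → 0 < x × x < y × x ∷ 0 ∷ y ∷ 0 ∷ [] ⊆ π
  contains⁻ {π} nd (ι@(i Vec.∷ j Vec.∷ k Vec.∷ l Vec.∷ Vec.[]) , incr , iso) =
    lookup π i , lookup π k , subst (_< lookup π i) j≡0 j<i , i<k ,
    subst₂ (λ y z → lookup π i ∷ y ∷ lookup π k ∷ z ∷ [] ⊆ π) j≡0 (trans l≡j j≡0) p
    where
    p : entries π ι ⊆ π
    p = entries-⊆ π ι incr
    j<i : lookup π j < lookup π i
    j<i = Equivalence.from (proj₁ (iso 1F 0F)) z<s
    i<k : lookup π i < lookup π k
    i<k = Equivalence.from (proj₁ (iso 0F 2F)) (n<1+n 1)
    j≡0 : lookup π j ≡ 0
    j≡0 = NoDescent⇒0 nd j<i p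
    l≡j : lookup π l ≡ lookup π j
    l≡j = Equivalence.from (proj₂ (iso 3F 1F)) refl

  stay⁺ : ∀ {m s w} → 1 < m → Ascending m m s w → Avoids₂ (m ∷ w) →
    Ascending m m s (m ∷ w) × Avoids₂ (m ∷ m ∷ w)
  stay⁺ {suc m} 1<m a av = level a , λ where
    1<y (_ ∷ʳ p)            → av 1<y p
    1<y (refl ∷ (_ ∷ʳ p))  → av 1<y (refl ∷ p)

  move⁻ : ∀ {m s x w} → 1 < m → Ascending m m s (x ∷ w) → Avoids₂ (m ∷ x ∷ w) →
    (x ≡ m × Ascending m m s w × Avoids₂ (m ∷ w)) ⊎
    (m < x × x ≤ suc s × Ascending x x (suc s) w)
  move⁻ 1<m (zero a)            av = contradiction (refl ∷ (refl ∷ minimum _)) (av 1<m)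
  move⁻ 1<m (level a)           av = inj₁ (refl , a , drop₂ av)
  move⁻ 1<m (rise m<x _ x≤ a) av = inj₂ (m<x , x≤ , a)

  rise⁺ : ∀ {m s x w} → 1 < m → m < x → Ascending x x s w → Avoids₂ (x ∷ w) → Avoids₂ (m ∷ x ∷ w)
  rise⁺ 1<m m<x a av 1<y (_ ∷ʳ p)            = av 1<y p
  -- A 0 further on in `w` also follows the larger entry `x`, where it is already forbidden.
  rise⁺ 1<m m<x a av 1<y (refl ∷ (_ ∷ʳ p))  = av (<-trans 1<m m<x) (refl ∷ p)
  rise⁺ 1<m ()  a av 1<y (refl ∷ (refl ∷ p))

tame1022 : Tame pattern1022 (const 0) id
tame1022 = record
  { contains⁻ = contains⁻
  ; contains⁺ = λ 0<x x<y → contains-image (threshold 0 _ _) (threshold-mono 0<x x<y) pattern1022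
  ; stay≤     = λ _ → z≤n
  ; stay⁺     = stay⁺
  ; move⁻     = move⁻
  ; rise⁺     = rise⁺
  }
  where
  open Residual id

  contains⁻ : ∀ {π} → NoDescent π → Contains π pattern1022 →
    ∃₂ λ x y → 0 < x × x < y × x ∷ 0 ∷ y ∷ y ∷ [] ⊆ π
  contains⁻ {π} nd (ι@(i Vec.∷ j Vec.∷ k Vec.∷ l Vec.∷ Vec.[]) , incr , iso) =
    lookup π i , lookup π k , subst (_< lookup π i) j≡0 j<i , i<k ,
    subst₂ (λ y z → lookup π i ∷ y ∷ lookup π k ∷ z ∷ [] ⊆ π) j≡0 l≡k p
    where
    p : entries π ι ⊆ π
    p = entries-⊆ π ι incr
    j<i : lookup π j < lookup π i
    j<i = Equivalence.from (proj₁ (iso 1F 0F)) z<s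
    i<k : lookup π i < lookup π k
    i<k = Equivalence.from (proj₁ (iso 0F 2F)) (n<1+n 1)
    j≡0 : lookup π j ≡ 0
    j≡0 = NoDescent⇒0 nd j<i p
    l≡k : lookup π l ≡ lookup π k
    l≡k = Equivalence.from (proj₂ (iso 3F 2F)) refl

  -- As m does not occur in w, it makes no difference whether 0 or m precedes w.
  change-last : ∀ {l l′ m s w} → 1 < m → l′ ≤ m → Avoids₂ (m ∷ w) → Ascending l m s w → Ascending l′ m s w
  change-last 1<m l′≤m av []        = []
  change-last 1<m l′≤m av (zero a)  = zero a
  change-last 1<m l′≤m av (level a) = contradiction (refl ∷ (refl ∷ minimum _)) (av 1<m)
  change-last 1<m l′≤m av (rise l<x m≤x x≤ a) with m≤n⇒m<n∨m≡n m≤x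
  ... | inj₁ m<x  = rise (≤-<-trans l′≤m m<x) m≤x x≤ a
  ... | inj₂ refl = contradiction (refl ∷ (refl ∷ minimum _)) (av 1<m)

  stay⁺ : ∀ {m s w} → 1 < m → Ascending m m s w → Avoids₂ (m ∷ w) →
    Ascending m m s (0 ∷ w) × Avoids₂ (m ∷ 0 ∷ w)
  stay⁺ 1<m a av = zero (change-last 1<m z≤n av a) , λ where
    1<y (_ ∷ʳ (_ ∷ʳ p))    → av 1<y (_ ∷ʳ p)
    ()  (_ ∷ʳ (refl ∷ p))
    1<y (refl ∷ (_ ∷ʳ p))  → av 1<y (refl ∷ p)
    ()  (refl ∷ (refl ∷ p))

  move⁻ : ∀ {m s x w} → 1 < m → Ascending m m s (x ∷ w) → Avoids₂ (m ∷ x ∷ w) →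
    (x ≡ 0 × Ascending m m s w × Avoids₂ (m ∷ w)) ⊎
    (m < x × x ≤ suc s × Ascending x x (suc s) w)
  move⁻ {m} {w = w} 1<m (zero a)     av = inj₁ (refl , change-last 1<m ≤-refl av′ a , av′)
    where
    av′ : Avoids₂ (m ∷ w)
    av′ 1<y (_ ∷ʳ p)    = av 1<y (_ ∷ʳ (_ ∷ʳ p))
    av′ 1<y (refl ∷ p) = av 1<y (refl ∷ (_ ∷ʳ p))
  move⁻ 1<m (level a)           av = contradiction (refl ∷ (refl ∷ minimum _)) (av 1<m)
  move⁻ 1<m (rise m<x _ x≤ a) av = inj₂ (m<x , x≤ , a)

  rise⁺ : ∀ {m s x w} → 1 < m → m < x → Ascending x x s w → Avoids₂ (x ∷ w) → Avoids₂ (m ∷ x ∷ w)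
  rise⁺ 1<m m<x a av 1<y (_ ∷ʳ p)            = av 1<y p
  -- A second `m` after the larger entry `x` would be a descent between positive entries.
  rise⁺ 1<m m<x a av 1<y (refl ∷ (_ ∷ʳ p))  = Ascending⇒NoDescent a (<⇒≤ 1<m) m<x (refl ∷ p)
  rise⁺ 1<m m<x a av 1<y (refl ∷ (refl ∷ p)) = <-irrefl refl m<x

-- From counting to the generating function.

b≡count : ∀ {τ stay g} → Tame τ stay g → ∀ n → b n τ ≡ Counting.count stay start n
b≡count {τ} {stay} tame n = trans
  -- Two duplicate-free lists with the same members are permutations of each other.
  (↭-length (∼bag⇒↭ (unique∧set⇒bag (B-unique n τ)
    (language-unique (increasing (Tame.stay≤ tame)) start n)
    λ {w} → mk⇔ (to ∘ Equivalence.to (∈-B n τ w)) (Equivalence.from (∈-B n τ w) ∘ from))))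
  (length-language start n)
  where
  open Counting stay
  to : ∀ {n w} → InB n τ w → w ∈ language start n
  to {w = w} (refl , acc) = ∈-language⁺ (Accepts tame) (accepts-[] tame)
    (accepts-∷⁻ tame) (accepts-∷⁺ tame) start w acc
  from : ∀ {w} → w ∈ language start n → InB n τ w
  from = ∈-language⁻ (Accepts tame) (accepts-[] tame)
    (accepts-∷⁻ tame) (accepts-∷⁺ tame) start n

module _ (stay : ℕ → ℕ) where
  open Counting stay

  counts-solution : SeriesAlgebra.Solution (λ n → + t 0 n) (λ n → + t 1 n) (λ n → + z 0 n)
    (λ n → + o 1 n) (λ n → + count (P 0) n) (λ n → + count zeros n)
  counts-solution = record
    { t₀-suc = λ n → cong +_ (t-suc 0 n)
    ; t₁-suc = λ n → cong +_ (t-suc 1 n)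
    ; z-suc  = λ n → cong +_ (z-suc 0 n)
    ; o-suc  = λ n → cong +_ (o₁-suc n)
    ; p-suc  = λ n → cong +_ (p-suc n)
    -- `zeros` leads to `zeros` and `ones`; the count of `ones` is replaced by solving
    -- `ones-balance` for it over the integers.
    ; a-suc  = λ n → cong (λ r → + count zeros n ℤ.+ r)
        (trans (cong +_ (+-identityʳ (count ones n)))
          (solve-balance (+ count ones n) (+ z 0 n) (+ t 1 n) (+ o 1 n) (+ count (P 0) n) (+ t 0 n)
            (cong +_ (ones-balance n))))
    }
    where
    solve-balance : ∀ y z t₁ o p t₀ → y ℤ.+ (z ℤ.+ t₁) ≡ o ℤ.+ (p ℤ.+ t₀) →
      y ≡ o ℤ.- z ℤ.+ (p ℤ.- t₁ ℤ.+ t₀)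
    solve-balance y z t₁ o p t₀ eq =
      trans (left y z t₁) (trans (cong (λ r → r ℤ.- (z ℤ.+ t₁)) eq) (right z t₁ o p t₀))
      where
      left : ∀ y z t₁ → y ≡ y ℤ.+ (z ℤ.+ t₁) ℤ.- (z ℤ.+ t₁)
      left = ℤ-RingSolver.solve-∀
      right : ∀ z t₁ o p t₀ → o ℤ.+ (p ℤ.+ t₀) ℤ.- (z ℤ.+ t₁) ≡ o ℤ.- z ℤ.+ (p ℤ.- t₁ ℤ.+ t₀)
      right = ℤ-RingSolver.solve-∀

  counting-series : Series
  counting-series n = + count start n

  numerator : Series
  numerator = polynomial (+ 1 ∷ - (+ 9) ∷ + 32 ∷ - (+ 56) ∷ + 49 ∷ - (+ 19) ∷ + 1 ∷ [])

  -- The numerator has degree 6: seven coefficients are compared by evaluation with `stay` left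
  -- abstract, and beyond them both sides vanish.
  denominator⊛counting-series : ∀ n → (SeriesAlgebra.denominator ⊛ counting-series) n ≡ numerator n
  denominator⊛counting-series 0 = refl
  denominator⊛counting-series 1 = refl
  denominator⊛counting-series 2 = refl
  denominator⊛counting-series 3 = refl
  denominator⊛counting-series 4 = refl
  denominator⊛counting-series 5 = refl
  denominator⊛counting-series 6 = refl
  denominator⊛counting-series (suc (suc (suc (suc (suc (suc (suc n))))))) =
    SeriesAlgebra.annihilated counts-solution counting-series
      (λ n → cong +_ (+-identityʳ (count zeros n))) n

tame⇒rational : ∀ {τ stay g} → Tame τ stay g →
  generatingFunction τ ≈ numerator stay /ˢ SeriesAlgebra.denominator
tame⇒rational {τ} {stay} tame = refl , λ n → trans
  (SeriesAlgebra.⊛-congʳ SeriesAlgebra.denominator {generatingFunction τ} {counting-series stay}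
    (λ k → cong +_ (b≡count tame k)) n)
  (denominator⊛counting-series stay n)

theorem2p9 : (τ : List ℕ) → τ ≡ pattern1020 ⊎ τ ≡ pattern1022 →
    generatingFunction τ ≈
    polynomial (+ 1 ∷ - (+ 9) ∷ + 32 ∷ - (+ 56) ∷ + 49 ∷ - (+ 19) ∷ + 1 ∷ [])
    /ˢ (polynomial (+ 1 ∷ - (+ 1) ∷ [])
    ⊛ polynomial (+ 1 ∷ - (+ 2) ∷ []) ^ˢ 3
    ⊛ polynomial (+ 1 ∷ - (+ 3) ∷ + 1 ∷ []))
theorem2p9 τ (inj₁ refl) = tame⇒rational tame1020
theorem2p9 τ (inj₂ refl) = tame⇒rational tame1022
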